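{- There is a primitive recursive function $g:\omega\to\omega$ such that for all $e,m\in\omega$ and all $X$, $$\langle g(e)\rangle^X(m)\downarrow\;\Longleftrightarrow\;\langle e\rangle^X(m)\Downarrow .$$
   Context: **Feedback computation.** Let $X\in{}^{\omega}\omega$ (or ${}^\omega 2$). Programs are ordinary oracle Turing machine programs (with oracle $X$), indexed by $e\in\omega$ in a standard way, with an additional instruction allowing the machine at any stage to issue a query $Q^X(e',m')$, with $e',m'$ integers computed by the machine, asking whether the feedback computation $\langle e'\rangle^X(m')$ converges or diverges, and receiving (in one step) an answer in $\{\downarrow,\uparrow\}$. Formally, for a partial function $C$ let $I(C)$ be the set of pairs $\langle\langle e,m,X\rangle,\langle j,k\rangle\rangle$ such that program $e$, run on input $m$ with oracle $X$, makes only queries $Q^X(e',m')$ for which $C(\langle e',m',X\rangle)=\langle j',k'\rangle$ is defined, each such query being answered by $j'$, and either this run halts with output $k\in\omega$ and $j=\,\downarrow$, or it runs forever and $j=\,\uparrow$, $k=\omega$. Let $I_\infty$ be the least fixed point of the monotone operator $I$, obtained by iteration from $\emptyset$. Write: - $\langle e\rangle^X(m)\downarrow$ (convergent) iff $I_\infty(\langle e,m,X\rangle)=\langle\downarrow,k\rangle$ for some $k\in\omega$; - $\langle e\rangle^X(m)\uparrow$ (divergent) iff $I_\infty(\langle e,m,X\rangle)=\langle\uparrow,\omega\rangle$; - $\langle e\rangle^X(m)\Downarrow$ (defined, non-freezing) iff it is convergent or divergent in this sense, i.e. $\langle e,m,X\rangle\in\mathrm{dom}(I_\infty)$; - $\langle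 e\rangle^X(m)\Uparrow$ (freezing) otherwise. -}

module Defs where

open import Data.Fin.Base using (Fin)
open import Data.List.Base using (List; []; _∷_; _++_; drop; head; replicate)
open import Data.Maybe.Base using (Maybe; just; nothing)
open import Data.Nat.Base using (ℕ; zero; suc; _+_)
open import Data.Nat.DivMod using (_/_; _%_)
open import Data.Product.Base using (_×_; _,_; ∃-syntax)
open import Data.Sum.Base using (_⊎_)
open import Data.Vec.Base using (Vec; []; _∷_; lookup; [_])
open import Relation.Binary.Construct.Closure.ReflexiveTransitive using (Star)
open import Relation.Binary.PropositionalEquality using (_≡_)

data PR : ℕ → Set where
  zeroᵖ : ∀ {n} → PR n
  sucᵖ  : PR 1
  projᵖ : ∀ {n} → Fin n → PR n
  compᵖ : ∀ {k n} → PR k → Vec (PR n) k → PR n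
  recᵖ  : ∀ {n} → PR n → PR (2 + n) → PR (1 + n)

eval    : ∀ {n} → PR n → Vec ℕ n → ℕ
evals   : ∀ {k n} → Vec (PR n) k → Vec ℕ n → Vec ℕ k
evalRec : ∀ {n} → PR n → PR (2 + n) → ℕ → Vec ℕ n → ℕ

eval zeroᵖ        xs       = 0
eval sucᵖ         (x ∷ []) = suc x
eval (projᵖ i)    xs       = lookup xs i
eval (compᵖ f gs) xs       = eval f (evals gs xs)
eval (recᵖ f h)   (x ∷ xs) = evalRec f h x xs

evals []       xs = []
evals (g ∷ gs) xs = eval g xs ∷ evals gs xs

evalRec f h zero    xs = eval f xs
evalRec f h (suc x) xs = eval h (x ∷ evalRec f h x xs ∷ xs)

PrimitiveRecursive : (ℕ → ℕ) → Set
PrimitiveRecursive g = ∃[ t ] (∀ n → eval {1} t [ n ] ≡ g n)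

Oracle : Set
Oracle = ℕ → ℕ

data Symbol : Set where
  blank stroke : Symbol

data Direction : Set where
  left right : Direction

State : Set
State = ℕ

data Instruction : Set where
  write    : Symbol → Direction → State → Instruction
  oracle   : State → Instruction
  feedback : (q↓ q↑ : State) → Instruction

-- Row q holds the instructions obeyed in state q when scanning a blank and
-- a stroke, respectively.  Computations start in state 0; a state without
-- a row is a halting state.
Program : Set
Program = List (Instruction × Instruction)

row : Program → State → Maybe (Instruction × Instruction)
row p q = head (drop q p)

-- A two-way infinite tape.  In l ◂ r the scanned cell is the first cell of
-- r, and l lists the cells to the left of it, nearest first; all cells
-- beyond the ends of the two lists are blank.
data Tape : Set where
  _◂_ : (l r : List Symbol) → Tape

scan : Tape → Symbol
scan (l ◂ [])      = blank
scan (l ◂ (s ∷ r)) = s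

writeMove : Symbol → Direction → Tape → Tape
writeMove s left  ([] ◂ r)      = [] ◂ (blank ∷ s ∷ drop 1 r)
writeMove s left  ((a ∷ l) ◂ r) = l ◂ (a ∷ s ∷ drop 1 r)
writeMove s right (l ◂ r)       = (s ∷ l) ◂ drop 1 r

-- Numbers are written in unary: the cells stroke^n blank hold n.
strokes : ℕ → List Symbol
strokes n = replicate n stroke

number : List Symbol → ℕ
number []           = 0
number (blank ∷ r)  = 0
number (stroke ∷ r) = suc (number r)

afterNumber : List Symbol → List Symbol
afterNumber []           = []
afterNumber (blank ∷ r)  = r
afterNumber (stroke ∷ r) = afterNumber r

record Config : Set where
  constructor _at_
  field
    state : State
    tape  : Tape

initial : ℕ → Config
initial m = 0 at ([] ◂ strokes m)

data Next : Set where
  halted : (output : ℕ) → Next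
  moved  : Config → Next
  asked  : (e′ m′ : ℕ) (if↓ if↑ : Config) → Next

-- An oracle instruction replaces the number n written from the scanned
-- cell onwards by X n, shifting what follows it.  A feedback instruction
-- takes e′ and m′ from the two consecutive numbers written from the
-- scanned cell onwards; the answer is received in the next state.
execute : Oracle → Instruction → Tape → Next
execute X (write s d q) t = moved (q at writeMove s d t)
execute X (oracle q) (l ◂ r) =
  moved (q at (l ◂ (strokes (X (number r)) ++ blank ∷ afterNumber r)))
execute X (feedback q↓ q↑) t@(l ◂ r) =
  asked (number r) (number (afterNumber r)) (q↓ at t) (q↑ at t)

select : Symbol → Instruction × Instruction → Instruction
select blank  (i , j) = i
select stroke (i , j) = j

next : Program → Oracle → Config → Next
next p X (q at t@(l ◂ r)) with row p q
... | nothing = halted (number r)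
... | just ij = execute X (select (scan t) ij) t

-- Inverse of Cantor's pairing function
-- (x , y) ↦ (x + y) (x + y + 1) / 2 + y.
unpair : ℕ → ℕ × ℕ
unpair zero = 0 , 0
unpair (suc n) with unpair n
... | zero  , y = suc y , 0
... | suc x , y = x , suc y

decodeInstruction : ℕ → Instruction
decodeInstruction n with n % 6
... | 0 = write blank  left  (n / 6)
... | 1 = write blank  right (n / 6)
... | 2 = write stroke left  (n / 6)
... | 3 = write stroke right (n / 6)
... | 4 = oracle (n / 6)
... | _ with unpair (n / 6)
...   | q↓ , q↑ = feedback q↓ q↑

decodeRow : ℕ → Instruction × Instruction
decodeRow n with unpair n
... | a , b = decodeInstruction a , decodeInstruction b

-- 0 codes the empty list and 1 + pair a b the list with head coded by a
-- and tail coded by b.  As b < 1 + pair a b, the code itself bounds the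
-- recursion depth, so fuel n suffices for code n.
decodeFuel : (fuel code : ℕ) → Program
decodeFuel zero    n    = []
decodeFuel (suc f) zero = []
decodeFuel (suc f) (suc n) with unpair n
... | a , b = decodeRow a ∷ decodeFuel f b

program : ℕ → Program
program e = decodeFuel e e

-- ↓⟨ k ⟩ stands for ⟨↓,k⟩ and ↑ω for ⟨↑,ω⟩.
data Outcome : Set where
  ↓⟨_⟩ : ℕ → Outcome
  ↑ω   : Outcome

-- Partial functions on triples ⟨e,m,X⟩ are given by their graphs.
Graph : Set₁
Graph = ℕ → ℕ → Oracle → Outcome → Set

data Step (C : Graph) (p : Program) (X : Oracle) (c : Config) : Config → Set where
  move : ∀ {c′} → next p X c ≡ moved c′ → Step C p X c c′
  ask↓ : ∀ {e′ m′ c↓ c↑ k} → next p X c ≡ asked e′ m′ c↓ c↑ →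
         C e′ m′ X ↓⟨ k ⟩ → Step C p X c c↓
  ask↑ : ∀ {e′ m′ c↓ c↑} → next p X c ≡ asked e′ m′ c↓ c↑ →
         C e′ m′ X ↑ω → Step C p X c c↑

data I (C : Graph) (e m : ℕ) (X : Oracle) : Outcome → Set where
  halts : ∀ {c k} → Star (Step C (program e) X) (initial m) c →
          next (program e) X c ≡ halted k → I C e m X ↓⟨ k ⟩
  runsForever : (run : ℕ → Config) → run 0 ≡ initial m →
                (∀ n → Step C (program e) X (run n) (run (suc n))) →
                I C e m X ↑ω

-- The least fixed point of I, as an inductive type.
data I∞ (e m : ℕ) (X : Oracle) : Outcome → Set where
  fix : ∀ {o} → I I∞ e m X o → I∞ e m X o

⟨_⟩^_[_]↓ : ℕ → Oracle → ℕ → Set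
⟨ e ⟩^ X [ m ]↓ = ∃[ k ] I∞ e m X ↓⟨ k ⟩

⟨_⟩^_[_]↑ : ℕ → Oracle → ℕ → Set
⟨ e ⟩^ X [ m ]↑ = I∞ e m X ↑ω

⟨_⟩^_[_]⇓ : ℕ → Oracle → ℕ → Set
⟨ e ⟩^ X [ m ]⇓ = ⟨ e ⟩^ X [ m ]↓ ⊎ ⟨ e ⟩^ X [ m ]↑

-- On input m, the program for g e prepends to m the number e and a
-- separating blank, issues the query Q(e,m), and halts whatever the answer.
-- Until the query it runs deterministically, so it converges exactly when the
-- query has an answer, and otherwise it freezes.
{-# OPTIONS --safe #-}
module Submission where

open import Defs
open import Data.Fin.Patterns using (0F; 1F; 2F)
open import Data.List.Base using (List; []; _∷_; _++_; drop; head)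
open import Data.List.Properties using (drop-drop)
open import Data.Maybe.Base using (just)
open import Data.Nat.Base using (ℕ; zero; suc; pred; _+_; _*_; _∸_; _≤_; s≤s)
open import Data.Nat.DivMod using (_/_; _%_; [m+kn]%n≡m%n; +-distrib-/-∣ʳ; m*n/n≡m)
open import Data.Nat.Divisibility using (n∣m*n)
open import Data.Nat.Properties using
  (+-comm; +-suc; +-identityʳ; m+n∸n≡m; m≤m+n; ≤-refl; ≤-trans; pred[m∸n]≡m∸[1+n])
open import Data.Product.Base using (_×_; _,_; ∃-syntax)
open import Data.Sum.Base using (inj₁; inj₂)
open import Data.Vec.Base using (Vec; []; _∷_; lookup)
open import Function.Bundles using (_⇔_; mk⇔)
open import Relation.Binary.Construct.Closure.ReflexiveTransitive using (Star; ε; _◅_; _◅◅_; map)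
open import Relation.Binary.PropositionalEquality using (_≡_; refl; sym; trans; cong; cong₂; subst)

-- Codes of programs

triangle : ℕ → ℕ
triangle zero    = 0
triangle (suc n) = suc (n + triangle n)

-- `unpair` walks along the diagonals `x + y = s`, and `triangle s` pairs precede diagonal `s`. The
-- predecessor of `(s + 1 , 0)` is `(0 , s)`, that of `(x , y + 1)` is `(x + 1 , y)`, so the
-- induction is lexicographic in `s` and `y`.
unpair-diagonal : ∀ s x y → x + y ≡ s → unpair (y + triangle s) ≡ (x , y)
unpair-diagonal zero    zero    zero    _  = refl
unpair-diagonal (suc s) x       zero    eq
  rewrite unpair-diagonal s 0 s refl = cong (_, 0) (trans (sym eq) (+-identityʳ x))
unpair-diagonal s       x       (suc y) eq
  rewrite unpair-diagonal s (suc x) y (trans (sym (+-suc x y)) eq) = refl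

-- Opaque because unfolding codes is prohibitively slow in conversion checking.
opaque
  pair : ℕ → ℕ → ℕ
  pair x y = y + triangle (x + y)

  unpair-pair : ∀ x y → unpair (pair x y) ≡ (x , y)
  unpair-pair x y = unpair-diagonal (x + y) x y refl

  y≤pair : ∀ x y → y ≤ pair x y
  y≤pair x y = m≤m+n y _

writeTag : Symbol → Direction → ℕ
writeTag blank  left  = 0
writeTag blank  right = 1
writeTag stroke left  = 2
writeTag stroke right = 3

codeInstruction : Instruction → ℕ
codeInstruction (write s d q)    = writeTag s d + q * 6
codeInstruction (oracle q)       = 4 + q * 6
codeInstruction (feedback q↓ q↑) = 5 + pair q↓ q↑ * 6

-- The quotient `t / 6` is left standing because it computes to 0 at each literal tag from 0 to 5.
[t+q*6]/6≡t/6+q : ∀ t q → (t + q * 6) / 6 ≡ t / 6 + q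
[t+q*6]/6≡t/6+q t q =
  trans (+-distrib-/-∣ʳ t (n∣m*n q {6})) (cong (t / 6 +_) (m*n/n≡m q 6))

[t+q*6]%6≡t%6 : ∀ t q → (t + q * 6) % 6 ≡ t % 6
[t+q*6]%6≡t%6 t q = [m+kn]%n≡m%n t q 6

decode-codeInstruction : ∀ i → decodeInstruction (codeInstruction i) ≡ i
decode-codeInstruction (write blank left q)
  rewrite [t+q*6]%6≡t%6 0 q | [t+q*6]/6≡t/6+q 0 q = refl
decode-codeInstruction (write blank right q)
  rewrite [t+q*6]%6≡t%6 1 q | [t+q*6]/6≡t/6+q 1 q = refl
decode-codeInstruction (write stroke left q)
  rewrite [t+q*6]%6≡t%6 2 q | [t+q*6]/6≡t/6+q 2 q = refl
decode-codeInstruction (write stroke right q)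
  rewrite [t+q*6]%6≡t%6 3 q | [t+q*6]/6≡t/6+q 3 q = refl
decode-codeInstruction (oracle q)
  rewrite [t+q*6]%6≡t%6 4 q | [t+q*6]/6≡t/6+q 4 q = refl
decode-codeInstruction (feedback q↓ q↑)
  rewrite [t+q*6]%6≡t%6 5 (pair q↓ q↑) | [t+q*6]/6≡t/6+q 5 (pair q↓ q↑)
        | unpair-pair q↓ q↑ = refl

codeRow : Instruction × Instruction → ℕ
codeRow (i , j) = pair (codeInstruction i) (codeInstruction j)

decode-codeRow : ∀ ij → decodeRow (codeRow ij) ≡ ij
decode-codeRow (i , j)
  rewrite unpair-pair (codeInstruction i) (codeInstruction j)
  = cong₂ _,_ (decode-codeInstruction i) (decode-codeInstruction j)

codeProgram : Program → ℕ
codeProgram []       = 0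
codeProgram (ij ∷ p) = suc (pair (codeRow ij) (codeProgram p))

-- The fuel is an arbitrary bound because the recursive call inherits what remains from the whole
-- list, not the code of the tail; `y≤pair` keeps the tail's code within it.
decodeFuel-codeProgram : ∀ f p → codeProgram p ≤ f → decodeFuel f (codeProgram p) ≡ p
decodeFuel-codeProgram zero    []       _ = refl
decodeFuel-codeProgram (suc f) []       _ = refl
decodeFuel-codeProgram (suc f) (ij ∷ p) (s≤s le)
  rewrite unpair-pair (codeRow ij) (codeProgram p)
  = cong₂ _∷_ (decode-codeRow ij)
      (decodeFuel-codeProgram f p (≤-trans (y≤pair _ (codeProgram p)) le))

program-codeProgram : ∀ p → program (codeProgram p) ≡ p
program-codeProgram p = decodeFuel-codeProgram (codeProgram p) p ≤-refl

-- Primitive recursive functions of several arguments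

IsPR : ∀ {n} → (Vec ℕ n → ℕ) → Set
IsPR {n} f = ∃[ t ] (∀ xs → eval {n} t xs ≡ f xs)

uncurry₂ : (ℕ → ℕ → ℕ) → Vec ℕ 2 → ℕ
uncurry₂ f (x ∷ y ∷ []) = f x y

proj-PR : ∀ {n} i → IsPR {n} (λ xs → lookup xs i)
proj-PR i = projᵖ i , λ _ → refl

suc-PR : ∀ {n} {f : Vec ℕ n → ℕ} → IsPR f → IsPR (λ xs → suc (f xs))
suc-PR (t , eq) = compᵖ sucᵖ (t ∷ []) , λ xs → cong suc (eq xs)

const-PR : ∀ {n} c → IsPR {n} (λ _ → c)
const-PR zero    = zeroᵖ , λ _ → refl
const-PR (suc c) = suc-PR (const-PR c)

comp₁-PR : ∀ {n} {h : ℕ → ℕ} {f : Vec ℕ n → ℕ} →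
           PrimitiveRecursive h → IsPR f → IsPR (λ xs → h (f xs))
comp₁-PR {h = h} (t , eq) (u , equ) =
  compᵖ t (u ∷ []) , λ xs → trans (eq _) (cong h (equ xs))

comp₂-PR : ∀ {n} {h : ℕ → ℕ → ℕ} {f g : Vec ℕ n → ℕ} →
           IsPR (uncurry₂ h) → IsPR f → IsPR g → IsPR (λ xs → h (f xs) (g xs))
comp₂-PR {h = h} (t , eq) (u , equ) (v , eqv) =
  compᵖ t (u ∷ v ∷ []) , λ xs → trans (eq _) (cong₂ h (equ xs) (eqv xs))

-- Since `r` need only satisfy the recursion equations pointwise, a function defined independently
-- of `PR` is covered by checking two equations.
rec-PR : ∀ {n} {f : Vec ℕ n → ℕ} {h : Vec ℕ (2 + n) → ℕ} (r : Vec ℕ (1 + n) → ℕ) →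
         IsPR f → IsPR h → (∀ xs → f xs ≡ r (0 ∷ xs)) →
         (∀ x xs → h (x ∷ r (x ∷ xs) ∷ xs) ≡ r (suc x ∷ xs)) → IsPR r
rec-PR {h = h} r (t , eqt) (u , equ) base step = recᵖ t u , λ { (x ∷ xs) → go x xs }
  where
  go : ∀ x xs → evalRec t u x xs ≡ r (x ∷ xs)
  go zero    xs = trans (eqt xs) (base xs)
  go (suc x) xs = trans (equ _)
    (trans (cong (λ y → h (x ∷ y ∷ xs)) (go x xs)) (step x xs))

unary-PR : ∀ {h : ℕ → ℕ} → IsPR {1} (λ xs → h (lookup xs 0F)) → PrimitiveRecursive h
unary-PR (t , eq) = t , λ _ → eq _

+-PR : IsPR (uncurry₂ _+_)
+-PR = rec-PR _ (proj-PR 0F) (suc-PR (proj-PR 1F))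
  (λ { (y ∷ []) → refl }) (λ { x (y ∷ []) → refl })

pred-PR : PrimitiveRecursive pred
pred-PR = unary-PR (rec-PR _ (const-PR 0) (proj-PR 0F) (λ _ → refl) (λ _ _ → refl))

*6-PR : PrimitiveRecursive (_* 6)
*6-PR = unary-PR (rec-PR _ (const-PR 0) (comp₂-PR +-PR (const-PR 6) (proj-PR 1F))
  (λ _ → refl) (λ _ _ → refl))

-- The arguments are swapped because `recᵖ` recurses on the first one and truncated subtraction
-- recurses on the subtrahend.
flip-∸-PR : IsPR (uncurry₂ (λ k n → n ∸ k))
flip-∸-PR = rec-PR _ (proj-PR 0F) (comp₁-PR pred-PR (proj-PR 1F))
  (λ { (n ∷ []) → refl }) (λ { k (n ∷ []) → pred[m∸n]≡m∸[1+n] n k })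

triangle-PR : PrimitiveRecursive triangle
triangle-PR = unary-PR (rec-PR _ (const-PR 0)
  (suc-PR (comp₂-PR +-PR (proj-PR 0F) (proj-PR 1F))) (λ _ → refl) (λ _ _ → refl))

opaque
  unfolding pair

  pair-PR : ∀ {n} {f g : Vec ℕ n → ℕ} → IsPR f → IsPR g → IsPR (λ xs → pair (f xs) (g xs))
  pair-PR f g = comp₂-PR +-PR g (comp₁-PR triangle-PR (comp₂-PR +-PR f g))

write-PR : ∀ {n} {q : Vec ℕ n → ℕ} s d →
           IsPR q → IsPR (λ xs → codeInstruction (write s d (q xs)))
write-PR s d q = comp₂-PR +-PR (const-PR (writeTag s d)) (comp₁-PR *6-PR q)

feedback-PR : ∀ {n} {q↓ q↑ : Vec ℕ n → ℕ} → IsPR q↓ → IsPR q↑ →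
              IsPR (λ xs → codeInstruction (feedback (q↓ xs) (q↑ xs)))
feedback-PR q↓ q↑ = comp₂-PR +-PR (const-PR 5) (comp₁-PR *6-PR (pair-PR q↓ q↑))

-- The querying program

always : Instruction → Instruction × Instruction
always i = i , i

-- The last k of the e rows that write the strokes of e, followed by the query.
-- The first row listed is that of state 2 + (e ∸ k).
queryRows : (e k : ℕ) → Program
queryRows e zero    =
  always (write blank right (3 + e)) ∷ always (feedback (4 + e) (4 + e)) ∷ []
queryRows e (suc k) = always (write stroke left (3 + (e ∸ suc k))) ∷ queryRows e k

-- State 0 steps left off the input and keeps its first symbol, state 1 leaves the separating blank,
-- and states 2 to `1 + e` write strokes from right to left. State `2 + e` returns to the start of
-- the number, `3 + e` asks, and `4 + e` has no row and so halts.
querier : ℕ → Program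
querier e =
  (write blank left 1 , write stroke left 1) ∷ always (write blank left 2) ∷ queryRows e e

-- The nonempty case of `codeProgram` on numbers alone: `a` and `b` code the two instructions of the
-- first row, `c` the remaining rows.
consCode : ℕ → ℕ → ℕ → ℕ
consCode a b c = suc (pair (pair a b) c)

cons-PR : ∀ {n} {a b c : Vec ℕ n → ℕ} → IsPR a → IsPR b → IsPR c →
          IsPR (λ xs → consCode (a xs) (b xs) (c xs))
cons-PR a b c = suc-PR (pair-PR (pair-PR a b) c)

-- The number of rows grows with `e`, so no fixed composition of pairings gives the code; it is
-- built by recursion on `k` with `e` as a parameter.
queryRows-PR : IsPR (uncurry₂ (λ k e → codeProgram (queryRows e k)))
queryRows-PR = rec-PR _
  (cons-PR return return (cons-PR query query (const-PR 0))) (cons-PR mark mark (proj-PR 1F))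
  (λ { (e ∷ []) → refl }) (λ { k (e ∷ []) → refl })
  where
  return : IsPR {1} (λ xs → codeInstruction (write blank right (3 + lookup xs 0F)))
  return = write-PR blank right (comp₂-PR +-PR (const-PR 3) (proj-PR 0F))

  query : IsPR {1} (λ xs → codeInstruction (feedback (4 + lookup xs 0F) (4 + lookup xs 0F)))
  query = feedback-PR halt halt
    where
    halt : IsPR {1} (λ xs → 4 + lookup xs 0F)
    halt = comp₂-PR +-PR (const-PR 4) (proj-PR 0F)

  mark : IsPR {3} (λ xs →
    codeInstruction (write stroke left (3 + (lookup xs 2F ∸ suc (lookup xs 0F)))))
  mark = write-PR stroke left
    (comp₂-PR +-PR (const-PR 3) (comp₂-PR flip-∸-PR (suc-PR (proj-PR 0F)) (proj-PR 2F)))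

querier-PR : PrimitiveRecursive (λ e → codeProgram (querier e))
querier-PR = unary-PR
  (cons-PR (write-PR blank left (const-PR 1)) (write-PR stroke left (const-PR 1))
    (cons-PR (write-PR blank left (const-PR 2)) (write-PR blank left (const-PR 2))
      (comp₂-PR queryRows-PR (proj-PR 0F) (proj-PR 0F))))

drop-queryRows : ∀ e j k → drop j (queryRows e (j + k)) ≡ queryRows e k
drop-queryRows e zero    k = refl
drop-queryRows e (suc j) k = drop-queryRows e j k

-- Here `j` rows have been passed and `k` writing rows remain. At `k = 0` the offsets `i = 0, 1, 2`
-- reach the returning row, the query and the missing row.
row-querier : ∀ {e} i j k → j + k ≡ e →
              row (querier e) (2 + (i + j)) ≡ head (drop i (queryRows e k))
row-querier i j k refl = cong head
  (trans (cong (λ n → drop n (queryRows (j + k) (j + k))) (+-comm i j))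
    (trans (sym (drop-drop j i _)) (cong (drop i) (drop-queryRows (j + k) j k))))

-- Its run

Move : Program → Oracle → Config → Config → Set
Move p X c c′ = next p X c ≡ moved c′

next-row : ∀ p X q t {ij} → row p q ≡ just ij →
           next p X (q at t) ≡ execute X (select (scan t) ij) t
next-row p X q (l ◂ r) eq rewrite eq = refl

next-always : ∀ p X q t {i} → row p q ≡ just (always i) →
              next p X (q at t) ≡ execute X i t
next-always p X q t eq with scan t | next-row p X q t eq
... | blank  | eq′ = eq′
... | stroke | eq′ = eq′

number-strokes : ∀ n r → number (strokes n ++ blank ∷ r) ≡ n
number-strokes zero    r = refl
number-strokes (suc n) r = cong suc (number-strokes n r)

afterNumber-strokes : ∀ n r → afterNumber (strokes n ++ blank ∷ r) ≡ r
afterNumber-strokes zero    r = refl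
afterNumber-strokes (suc n) r = afterNumber-strokes n r

number-strokes-end : ∀ n → number (strokes n) ≡ n
number-strokes-end zero    = refl
number-strokes-end (suc n) = cong suc (number-strokes-end n)

-- The head stands just left of the `j` strokes written so far; `r` holds the input.
writing : ℕ → List Symbol → Tape
writing j r = [] ◂ (blank ∷ strokes j ++ blank ∷ r)

querying : ℕ → List Symbol → Tape
querying e r = (blank ∷ []) ◂ (strokes e ++ blank ∷ r)

module _ (e : ℕ) (X : Oracle) where

  write-strokes : ∀ j k r → j + k ≡ e →
    Star (Move (querier e) X) ((2 + j) at writing j r) ((2 + e) at writing e r)
  write-strokes j zero    r eq rewrite trans (sym (+-identityʳ j)) eq = ε
  write-strokes j (suc k) r eq =
    next-always (querier e) X (2 + j) (writing j r) rowⱼ ◅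
    write-strokes (suc j) k r (trans (sym (+-suc j k)) eq)
    where
    rowⱼ : row (querier e) (2 + j) ≡ just (always (write stroke left (3 + j)))
    rowⱼ = trans (row-querier 0 j (suc k) eq)
      (cong (λ q → just (always (write stroke left (3 + q))))
        -- The row names its target through `e ∸ suc k`, which is `j` because `j + suc k ≡ e`.
        (subst (λ n → n ∸ suc k ≡ j) eq (m+n∸n≡m j (suc k))))

  moves-to-query : ∀ m → ∃[ r ] (number r ≡ m ×
    Star (Move (querier e) X) (initial m) ((3 + e) at querying e r))
  moves-to-query m with start m
    where
    -- For m = 0 the scanned blank has become an explicit cell of the tape.
    start : ∀ m → ∃[ r ] (number r ≡ m ×
      Star (Move (querier e) X) (initial m) (2 at writing 0 r))
    start zero    = blank ∷ [] , refl , refl ◅ refl ◅ ε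
    start (suc m) = strokes (suc m) , number-strokes-end (suc m) , refl ◅ refl ◅ ε
  ... | r , r≡m , moves =
    r , r≡m , moves ◅◅ write-strokes 0 e r refl ◅◅
      next-always (querier e) X (2 + e) (writing e r) (row-querier 0 e 0 (+-identityʳ e)) ◅ ε

  asks : ∀ r → next (querier e) X ((3 + e) at querying e r) ≡
    asked e (number r) ((4 + e) at querying e r) ((4 + e) at querying e r)
  asks r = trans
    (next-always (querier e) X (3 + e) (querying e r) (row-querier 1 e 0 (+-identityʳ e)))
    (cong₂ (λ e′ r′ → asked e′ (number r′) after after) (number-strokes e r) (afterNumber-strokes e r))
    where
    after : Config
    after = (4 + e) at querying e r

  halts-after-query : ∀ l r → ∃[ k ] (next (querier e) X ((4 + e) at (l ◂ r)) ≡ halted k)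
  halts-after-query l r rewrite row-querier 2 e 0 (+-identityʳ e) = number r , refl

-- As `next` is a function, a halting run has to follow the given moves as far as `b`. There it can
-- neither halt nor move, so its next step is an `ask↓` or `ask↑`, which carries the outcome in `C`.
halting-run-answers : ∀ {C p X e m a b c c↓ c↑ k} →
  Star (Move p X) a b → next p X b ≡ asked e m c↓ c↑ →
  Star (Step C p X) a c → next p X c ≡ halted k → ∃[ o ] C e m X o
halting-run-answers ε ask ε halt with () ← trans (sym ask) halt
halting-run-answers ε ask (move mv ◅ _) halt with () ← trans (sym ask) mv
halting-run-answers ε ask (ask↓ ask′ answer ◅ _) halt with refl ← trans (sym ask) ask′ = _ , answer
halting-run-answers ε ask (ask↑ ask′ answer ◅ _) halt with refl ← trans (sym ask) ask′ = _ , answer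
halting-run-answers (mv ◅ _) ask ε halt with () ← trans (sym mv) halt
halting-run-answers (mv ◅ moves) ask (move mv′ ◅ steps) halt with refl ← trans (sym mv) mv′ =
  halting-run-answers moves ask steps halt
halting-run-answers (mv ◅ _) ask (ask↓ ask′ _ ◅ _) halt with () ← trans (sym mv) ask′
halting-run-answers (mv ◅ _) ask (ask↑ ask′ _ ◅ _) halt with () ← trans (sym mv) ask′

module _ (e m : ℕ) (X : Oracle) where

  querier-↓⇒⇓ : ⟨ codeProgram (querier e) ⟩^ X [ m ]↓ → ⟨ e ⟩^ X [ m ]⇓
  querier-↓⇒⇓ (k , fix (halts steps halt))
    rewrite program-codeProgram (querier e)
    -- Matching `refl` turns `m` into `number r`, the argument that the query reads off the tape.
    with r , refl , moves ← moves-to-query e X m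
    with halting-run-answers moves (asks e X r) steps halt
  ... | ↓⟨ k′ ⟩ , converges = inj₁ (k′ , converges)
  ... | ↑ω      , diverges  = inj₂ diverges

  ⇓⇒querier-↓ : ⟨ e ⟩^ X [ m ]⇓ → ⟨ codeProgram (querier e) ⟩^ X [ m ]↓
  ⇓⇒querier-↓ defined
    with r , refl , moves ← moves-to-query e X m
    -- This is the tape `querying e r` spelled out; a query leaves the tape unchanged.
    with k , halt ← halts-after-query e X (blank ∷ []) (strokes e ++ blank ∷ r) =
    k , fix (subst-program (map move moves ◅◅ answered defined ◅ ε) halt)
    where
    answered : ⟨ e ⟩^ X [ number r ]⇓ →
      Step I∞ (querier e) X ((3 + e) at querying e r) ((4 + e) at querying e r)
    answered (inj₁ (_ , converges)) = ask↓ (asks e X r) converges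
    answered (inj₂ diverges)        = ask↑ (asks e X r) diverges

    -- `I` runs the program decoded from the code, so the run of `querier e` is transported back
    -- along `program-codeProgram`.
    subst-program : ∀ {m c k} → Star (Step I∞ (querier e) X) (initial m) c →
      next (querier e) X c ≡ halted k → I I∞ (codeProgram (querier e)) m X ↓⟨ k ⟩
    subst-program {m} {c} {k} steps halt = halts
      (subst (λ p → Star (Step I∞ p X) (initial m) c) (sym (program-codeProgram (querier e))) steps)
      (subst (λ p → next p X c ≡ halted k) (sym (program-codeProgram (querier e))) halt)

lemma1p8 : ∃[ g ] (PrimitiveRecursive g ×
    (∀ (e m : ℕ) (X : Oracle) → ⟨ g e ⟩^ X [ m ]↓ ⇔ ⟨ e ⟩^ X [ m ]⇓))
lemma1p8 = (λ e → codeProgram (querier e)) , querier-PR ,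
  λ e m X → mk⇔ (querier-↓⇒⇓ e m X) (⇓⇒querier-↓ e m X)
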